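{- For all integers $m,i$ with $1\leq i\leq m-1$, $$\frac{(i+1)(i+2)(m+i+3)^2}{(m+1-i)(m+2-i)(m+i+2)^2} <\frac{d_{i}^{2}(m)-d_{i-1}(m)d_{i+1}(m)}{d_{i+1}^{2}(m)-d_{i}(m)d_{i+2}(m)}.$$
   Context: For integers $m\ge 0$ and $0\le i\le m$, the Boros-Moll numbers are $$d_i(m)=2^{ -2m}\sum_{k=i}^m 2^k\binom{2m-2k}{m-k}\binom{m+k}{k}\binom{k}{i},$$ with the convention $d_i(m)=0$ for $i<0$ or $i>m$. The notation $d_i^{2}(m)$ means $(d_i(m))^2$. -}

module Defs where

open import Data.Integer.Base using (+_)
open import Data.List.Base using (applyUpTo)
open import Data.Nat.Base
open import Data.Nat.Combinatorics using (_C_)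
open import Data.Nat.ListAction using (sum)
open import Data.Nat.Properties using (m<n⇒0<n∸m; m<n⇒m<1+n; m^n≢0; m*n≢0; +-comm)
open import Data.Rational.Base as ℚ using (ℚ)
open import Relation.Binary.PropositionalEquality using (subst; sym)

infix 9 _²

_² : ℚ → ℚ
p ² = p ℚ.* p

-- The inclusive sum f a + f (a + 1) + ⋯ + f b, which is 0 when b < a.
∑[_⋯_] : ℕ → ℕ → (ℕ → ℕ) → ℕ
∑[ a ⋯ b ] f = sum (applyUpTo (λ j → f (a + j)) (suc b ∸ a))

-- The Boros-Moll number d_i(m).  For i > m the sum is empty, which gives the
-- conventional value 0.  In the sum k ≤ m, so the subtractions are exact.
d : ℕ → ℕ → ℚ
d m i =
  (+ ∑[ i ⋯ m ] (λ k →
        2 ^ k * ((2 * m ∸ 2 * k) C (m ∸ k)) * ((m + k) C k) * (k C i)))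
  ℚ./ (2 ^ (2 * m))
  where instance _ = m^n≢0 2 (2 * m)

bound-denominator≢0 : ∀ {m i} → i < m →
  NonZero ((m + 1 ∸ i) * (m + 2 ∸ i) * (m + i + 2) ^ 2)
bound-denominator≢0 {m} {i} i<m =
  m*n≢0 ((m + 1 ∸ i) * (m + 2 ∸ i)) ((m + i + 2) ^ 2)
  where
  i<1+m : i < m + 1
  i<1+m = subst (i <_) (sym (+-comm m 1)) (m<n⇒m<1+n i<m)

  i<2+m : i < m + 2
  i<2+m = subst (i <_) (sym (+-comm m 2)) (m<n⇒m<1+n (m<n⇒m<1+n i<m))

  instance
    m+i+2≢0 : NonZero (m + i + 2)
    m+i+2≢0 = subst NonZero (sym (+-comm (m + i) 2)) _

    [m+i+2]²≢0 : NonZero ((m + i + 2) ^ 2)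
    [m+i+2]²≢0 = m^n≢0 (m + i + 2) 2 {{m+i+2≢0}}

    [m+1-i][m+2-i]≢0 : NonZero ((m + 1 ∸ i) * (m + 2 ∸ i))
    [m+1-i][m+2-i]≢0 = m*n≢0 (m + 1 ∸ i) (m + 2 ∸ i)
      {{>-nonZero (m<n⇒0<n∸m i<1+m)}} {{>-nonZero (m<n⇒0<n∸m i<2+m)}}

{-# OPTIONS --safe #-}

-- Fix m, let D_i = 4^m d_i(m) and n = m - i.  The D_i satisfy the three-term recurrence
--   (m-i)(m+i+1) D_i + (i+1)(i+2) D_{i+2} = (i+1)(2m+1) D_{i+1},
-- which, run downwards from D_{m+1} = 0, preserves the bounds
--   2n / (2i+3) ≤ D_{i+1} / D_i ≤ n / (i+1).
-- The lower bound at i and the upper bound at i+1 give D_i D_{i+2} < D_{i+1}².  Eliminating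
-- D_{i-1} and D_{i+2} by the recurrence turns
--   n² ((n+1)(n+2)(m+i)(D_i² - D_{i-1} D_{i+1}) - (i+1)(i+2)(m+i+2)(D_{i+1}² - D_i D_{i+2}))
-- into a quadratic form in D_i and D_{i+1}; written in the two slacks
--   u = (2i+3) D_{i+1} - 2n D_i  and  v = n D_i - (i+1) D_{i+1}
-- it has nonnegative coefficients.  Finally s (s+3)² < (s+2)³ for s = m + i.

module Submission where

open import Defs

-- Integer inequalities for solutions of the three-term recurrence.

module IntegerInequalities where
  open import Data.Integer.Base hiding (suc)
  open import Data.Integer.Properties
  open import Data.Nat.Base using (suc; z≤n; z<s)
  open import Data.Integer.Tactic.RingSolver using (solve-∀)
  open import Relation.Binary.PropositionalEquality using (_≡_; sym; trans; cong; subst; subst₂)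

  -- Read x, y, z as D_i, D_{i+1}, D_{i+2} and n as m - i, so that m + i + 1 is 2 i + n + 1.
  Recurrence : ℤ → ℤ → ℤ → ℤ → ℤ → Set
  Recurrence i n x y z =
    n * (+ 2 * i + n + + 1) * x + (i + + 1) * (i + + 2) * z ≡
    (i + + 1) * (+ 2 * i + + 2 * n + + 1) * y

  record RatioBounds (i n x y : ℤ) : Set where
    constructor bounds
    field
      lower : 0ℤ ≤ (+ 2 * i + + 3) * y - + 2 * n * x
      upper : 0ℤ ≤ n * x - (i + + 1) * y

  -- This lets the ring solver work modulo a hypothesis `l ≡ r`: the solver proves an identity with
  -- an explicit cofactor `k`, and the last summand then vanishes.
  add-multiple : ∀ {x y} k {l r} → l ≡ r → x ≡ y + k * (l - r) → x ≡ y
  add-multiple {y = y} k {l} {r} l≡r eq = trans eq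
    (trans (cong (λ t → y + k * t) (i≡j⇒i-j≡0 {l} {r} l≡r))
      (trans (cong (λ t → y + t) (*-zeroʳ k)) (+-identityʳ y)))

  0<i-j⇒j<i : ∀ {i j} → 0ℤ < i - j → j < i
  0<i-j⇒j<i {i} {j} 0<i-j =
    subst₂ _<_ (+-identityˡ j) (restore i j) (+-monoˡ-< j 0<i-j)
    where
    restore : ∀ i j → i - j + j ≡ i
    restore = solve-∀

  private
    infix 8 ‵_ ‵⁺_
    infixl 6 _⟨+⟩_
    infixl 7 _⟨*⟩_

    -- With these operators a sign proof copies the shape of the polynomial it is about; the
    -- versions marked ⁺ conclude strict positivity.
    _⟨+⟩_ : ∀ {x y} → 0ℤ ≤ x → 0ℤ ≤ y → 0ℤ ≤ x + y
    _⟨+⟩_ = +-mono-≤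

    _⟨*⟩_ : ∀ {x y} → 0ℤ ≤ x → 0ℤ ≤ y → 0ℤ ≤ x * y
    _⟨*⟩_ {x} 0≤x 0≤y =
      subst (_≤ x * _) (*-zeroʳ x) (*-monoˡ-≤-nonNeg x {{nonNegative 0≤x}} 0≤y)

    ‵_ : ∀ k → 0ℤ ≤ + k
    ‵ k = +≤+ z≤n

    infixl 6 _⟨+⟩⁺_
    infixl 7 _⟨*⟩⁺_

    _⟨+⟩⁺_ : ∀ {x y} → 0ℤ ≤ x → 0ℤ < y → 0ℤ < x + y
    _⟨+⟩⁺_ = +-mono-≤-<

    _⟨*⟩⁺_ : ∀ {x y} → 0ℤ < x → 0ℤ < y → 0ℤ < x * y
    _⟨*⟩⁺_ {x} 0<x 0<y =
      subst (_< x * _) (*-zeroʳ x) (*-monoˡ-<-pos x {{positive 0<x}} 0<y)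

    ‵⁺_ : ∀ k → 0ℤ < + suc k
    ‵⁺ k = +<+ z<s

    cancel-positive⁺ : ∀ {x y} → 0ℤ ≤ x → 0ℤ < x * y → 0ℤ < y
    cancel-positive⁺ {x} {y} 0≤x 0<xy =
      *-cancelˡ-<-nonNeg {0ℤ} {y} x {{nonNegative 0≤x}} (subst (_< x * y) (sym (*-zeroʳ x)) 0<xy)

    cancel-positive : ∀ {x y} → 0ℤ < x → 0ℤ ≤ x * y → 0ℤ ≤ y
    cancel-positive {x} {y} 0<x 0≤xy =
      *-cancelˡ-≤-pos 0ℤ y x {{positive 0<x}} (subst (_≤ x * y) (sym (*-zeroʳ x)) 0≤xy)

  -- Bounds on the ratio of neighbouring numbers, by descent in i.

  -- Here `n` belongs to the index i + 1, so m - i is `1 + n`. The multiple of the recurrence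
  -- eliminates x, and z survives only inside the slack at i + 1. The leftover is 3ny; in
  -- `upper-step` it is (i+1)y.
  lower-step : ∀ i n x y z →
    (+ 2 * i + + 5) * (+ 2 * i + n + + 2) *
      ((+ 2 * i + + 3) * y - + 2 * (+ 1 + n) * x) ≡
    + 3 * n * y + + 2 * (i + + 1) * (i + + 2) *
      ((+ 2 * (+ 1 + i) + + 3) * z - + 2 * n * y)
    + (- (+ 2 * (+ 2 * i + + 5))) *
      ((+ 1 + n) * (+ 2 * i + (+ 1 + n) + + 1) * x + (i + + 1) * (i + + 2) * z
        - (i + + 1) * (+ 2 * i + + 2 * (+ 1 + n) + + 1) * y)
  lower-step = solve-∀

  upper-step : ∀ i n x y z →
    (+ 2 * i + n + + 2) * ((+ 1 + n) * x - (i + + 1) * y) ≡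
    (i + + 1) * (n * y - (+ 1 + i + + 1) * z) + (i + + 1) * y
    + + 1 *
      ((+ 1 + n) * (+ 2 * i + (+ 1 + n) + + 1) * x + (i + + 1) * (i + + 2) * z
        - (i + + 1) * (+ 2 * i + + 2 * (+ 1 + n) + + 1) * y)
  upper-step = solve-∀

  ratioBounds-step : ∀ {i n x y z} → 0ℤ ≤ i → 0ℤ ≤ n → 0ℤ ≤ y →
    Recurrence i (+ 1 + n) x y z → RatioBounds (+ 1 + i) n y z →
    RatioBounds i (+ 1 + n) x y
  ratioBounds-step {i} {n} {x} {y} {z} 0≤i 0≤n 0≤y rec (bounds lower upper) = bounds
    (cancel-positive ((‵ 2 ⟨*⟩ 0≤i ⟨+⟩⁺ ‵⁺ 4) ⟨*⟩⁺ (‵ 2 ⟨*⟩ 0≤i ⟨+⟩ 0≤n ⟨+⟩⁺ ‵⁺ 1))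
      (subst (0ℤ ≤_)
        (sym (add-multiple (- (+ 2 * (+ 2 * i + + 5))) rec (lower-step i n x y z)))
        (‵ 3 ⟨*⟩ 0≤n ⟨*⟩ 0≤y ⟨+⟩
          ‵ 2 ⟨*⟩ (0≤i ⟨+⟩ ‵ 1) ⟨*⟩ (0≤i ⟨+⟩ ‵ 2) ⟨*⟩ lower)))
    (cancel-positive (‵ 2 ⟨*⟩ 0≤i ⟨+⟩ 0≤n ⟨+⟩⁺ ‵⁺ 1)
      (subst (0ℤ ≤_) (sym (add-multiple (+ 1) rec (upper-step i n x y z)))
        ((0≤i ⟨+⟩ ‵ 1) ⟨*⟩ upper ⟨+⟩ (0≤i ⟨+⟩ ‵ 1) ⟨*⟩ 0≤y)))

  -- Log-concavity and the comparison of consecutive differences.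

  -- The xy terms of the two slack products cancel. The remaining multiple of y² keeps the right
  -- side positive even when both slacks vanish.
  log-concavity-identity : ∀ i n x y z →
    + 2 * (+ 1 + n) * (i + + 2) * (y * y - x * z) ≡
    n * y * ((+ 2 * i + + 3) * y - + 2 * (+ 1 + n) * x) +
    + 2 * (+ 1 + n) * x * (n * y - (+ 1 + i + + 1) * z) +
    (n + + 2 * i + + 4) * (y * y)
  log-concavity-identity = solve-∀

  log-concave : ∀ {i n x y z} → 0ℤ ≤ i → 0ℤ ≤ n → 0ℤ ≤ x → 0ℤ < y →
    RatioBounds i (+ 1 + n) x y → RatioBounds (+ 1 + i) n y z →
    0ℤ < y * y - x * z
  log-concave {i} {n} {x} {y} {z} 0≤i 0≤n 0≤x 0<y (bounds lower _) (bounds _ upper) =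
    cancel-positive⁺ (‵ 2 ⟨*⟩ (‵ 1 ⟨+⟩ 0≤n) ⟨*⟩ (0≤i ⟨+⟩ ‵ 2))
      (subst (0ℤ <_) (sym (log-concavity-identity i n x y z))
        (0≤n ⟨*⟩ <⇒≤ 0<y ⟨*⟩ lower ⟨+⟩
         ‵ 2 ⟨*⟩ (‵ 1 ⟨+⟩ 0≤n) ⟨*⟩ 0≤x ⟨*⟩ upper ⟨+⟩⁺
         (0≤n ⟨+⟩ ‵ 2 ⟨*⟩ 0≤i ⟨+⟩⁺ ‵⁺ 3) ⟨*⟩⁺ (0<y ⟨*⟩⁺ 0<y)))

  -- The last two summands vanish by the recurrences at i and i - 1; w, x, y, z are
  -- D_{i-1}, D_i, D_{i+1}, D_{i+2}.
  turán-identity : ∀ i n w x y z →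
    n * n *
      ((n + + 1) * (n + + 2) * (i + n + i) * (x * x - w * y)
        - (i + + 1) * (i + + 2) * (i + n + i + + 2) * (y * y - x * z)) ≡
    (i + + 1) * (n * n + + 2 * n * (i * i + + 3 * i + + 1) + + 4 * i * (i + + 1)) *
      (((+ 2 * i + + 3) * y - + 2 * n * x) * ((+ 2 * i + + 3) * y - + 2 * n * x))
    + (+ 2 * n * n * n + n * n * (+ 6 * i + + 9) + n * (+ 4 * i * i * i + + 30 * i * i + + 38 * i + + 10)
        + + 8 * i * (+ 2 * i * i + + 5 * i + + 3)) *
      (((+ 2 * i + + 3) * y - + 2 * n * x) * (n * x - (i + + 1) * y))
    + (+ 4 * n * n * n + n * n * (+ 6 * i + + 14) + n * (+ 24 * i * i + + 44 * i + + 12)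
        + + 4 * i * (+ 4 * i * i + + 12 * i + + 9)) *
      ((n * x - (i + + 1) * y) * (n * x - (i + + 1) * y))
    + n * n * (i + n + i + + 2) * x *
      (n * (+ 2 * i + n + + 1) * x + (i + + 1) * (i + + 2) * z
        - (i + + 1) * (+ 2 * i + + 2 * n + + 1) * y)
    + (- (n * n * (n + + 2) * y)) *
      ((+ 1 + n) * (+ 2 * (i - + 1) + (+ 1 + n) + + 1) * w + ((i - + 1) + + 1) * ((i - + 1) + + 2) * y
        - ((i - + 1) + + 1) * (+ 2 * (i - + 1) + + 2 * (+ 1 + n) + + 1) * x)
  turán-identity = solve-∀

  -- In terms of the slacks, y = u + 2v and n x = (i+1) u + (2i+3) v. The factor n² therefore clears
  -- all denominators when the quadratic form in x and y is rewritten in u and v.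
  turán-bound : ∀ {i n w x y z} → 0ℤ ≤ i → 0ℤ < n →
    Recurrence (i - + 1) (+ 1 + n) w x y → Recurrence i n x y z → RatioBounds i n x y →
    0ℤ ≤ (n + + 1) * (n + + 2) * (i + n + i) * (x * x - w * y)
       - (i + + 1) * (i + + 2) * (i + n + i + + 2) * (y * y - x * z)
  turán-bound {i} {n} {w} {x} {y} {z} 0≤i 0<n rec₁ rec₂ (bounds lower upper) =
    cancel-positive (0<n ⟨*⟩⁺ 0<n)
      -- The summand of `rec₁` stands last in the identity and is stripped first, then that of
      -- `rec₂`. The three groups below are the coefficients of u², uv and v².
      (subst (0ℤ ≤_)
        (sym (add-multiple (n * n * (i + n + i + + 2) * x) rec₂
          (add-multiple (- (n * n * (n + + 2) * y)) rec₁ (turán-identity i n w x y z))))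
        ((0≤i ⟨+⟩ ‵ 1) ⟨*⟩ (0≤n ⟨*⟩ 0≤n
             ⟨+⟩ ‵ 2 ⟨*⟩ 0≤n ⟨*⟩ (0≤i ⟨*⟩ 0≤i ⟨+⟩ ‵ 3 ⟨*⟩ 0≤i ⟨+⟩ ‵ 1)
             ⟨+⟩ ‵ 4 ⟨*⟩ 0≤i ⟨*⟩ (0≤i ⟨+⟩ ‵ 1))
           ⟨*⟩ (lower ⟨*⟩ lower)
         ⟨+⟩ (‵ 2 ⟨*⟩ 0≤n ⟨*⟩ 0≤n ⟨*⟩ 0≤n
             ⟨+⟩ 0≤n ⟨*⟩ 0≤n ⟨*⟩ (‵ 6 ⟨*⟩ 0≤i ⟨+⟩ ‵ 9)
             ⟨+⟩ 0≤n ⟨*⟩ (‵ 4 ⟨*⟩ 0≤i ⟨*⟩ 0≤i ⟨*⟩ 0≤i ⟨+⟩ ‵ 30 ⟨*⟩ 0≤i ⟨*⟩ 0≤i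
               ⟨+⟩ ‵ 38 ⟨*⟩ 0≤i ⟨+⟩ ‵ 10)
             ⟨+⟩ ‵ 8 ⟨*⟩ 0≤i ⟨*⟩ (‵ 2 ⟨*⟩ 0≤i ⟨*⟩ 0≤i ⟨+⟩ ‵ 5 ⟨*⟩ 0≤i ⟨+⟩ ‵ 3))
           ⟨*⟩ (lower ⟨*⟩ upper)
         ⟨+⟩ (‵ 4 ⟨*⟩ 0≤n ⟨*⟩ 0≤n ⟨*⟩ 0≤n
             ⟨+⟩ 0≤n ⟨*⟩ 0≤n ⟨*⟩ (‵ 6 ⟨*⟩ 0≤i ⟨+⟩ ‵ 14)
             ⟨+⟩ 0≤n ⟨*⟩ (‵ 24 ⟨*⟩ 0≤i ⟨*⟩ 0≤i ⟨+⟩ ‵ 44 ⟨*⟩ 0≤i ⟨+⟩ ‵ 12)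
             ⟨+⟩ ‵ 4 ⟨*⟩ 0≤i ⟨*⟩ (‵ 4 ⟨*⟩ 0≤i ⟨*⟩ 0≤i ⟨+⟩ ‵ 12 ⟨*⟩ 0≤i ⟨+⟩ ‵ 9))
           ⟨*⟩ (upper ⟨*⟩ upper)))
    where
    0≤n : 0ℤ ≤ n
    0≤n = <⇒≤ 0<n

  -- The remainder comes from (s+2)³ - s(s+3)² = 3s + 8. It turns the weak bound with factors s and
  -- s + 2 into a strict one with their shifted squares.
  square-shift : ∀ s a b p q →
    s * (a * ((s + + 2) * (s + + 2)) * p - b * ((s + + 3) * (s + + 3)) * q) ≡
    (s + + 2) * (s + + 2) * (a * s * p - b * (s + + 2) * q) + b * (+ 3 * s + + 8) * q
  square-shift = solve-∀

  square-shift-< : ∀ {s a b p q} → 0ℤ ≤ s → 0ℤ < b → 0ℤ < q →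
    0ℤ ≤ a * s * p - b * (s + + 2) * q →
    0ℤ < a * ((s + + 2) * (s + + 2)) * p - b * ((s + + 3) * (s + + 3)) * q
  square-shift-< {s} {a} {b} {p} {q} 0≤s 0<b 0<q h = cancel-positive⁺ 0≤s
    (subst (0ℤ <_) (sym (square-shift s a b p q))
      ((0≤s ⟨+⟩ ‵ 2) ⟨*⟩ (0≤s ⟨+⟩ ‵ 2) ⟨*⟩ h ⟨+⟩⁺
       0<b ⟨*⟩⁺ (‵ 3 ⟨*⟩ 0≤s ⟨+⟩⁺ ‵⁺ 7) ⟨*⟩⁺ 0<q))

  turán-ratio-bound : ∀ {i n w x y z} → 0ℤ ≤ i → 0ℤ < n →
    Recurrence (i - + 1) (+ 1 + n) w x y → Recurrence i n x y z → RatioBounds i n x y →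
    0ℤ < y * y - x * z →
    (i + + 1) * (i + + 2) * ((i + n + i + + 3) * (i + n + i + + 3)) * (y * y - x * z) <
    (n + + 1) * (n + + 2) * ((i + n + i + + 2) * (i + n + i + + 2)) * (x * x - w * y)
  turán-ratio-bound {i} {n} {w} {x} {y} {z} 0≤i 0<n rec₁ rec₂ rb 0<gap = 0<i-j⇒j<i
    (square-shift-< {i + n + i} {(n + + 1) * (n + + 2)} {(i + + 1) * (i + + 2)}
      {x * x - w * y} {y * y - x * z}
      (0≤i ⟨+⟩ <⇒≤ 0<n ⟨+⟩ 0≤i) ((0≤i ⟨+⟩⁺ ‵⁺ 0) ⟨*⟩⁺ (0≤i ⟨+⟩⁺ ‵⁺ 1)) 0<gap
      (turán-bound {i} {n} {w} {x} {y} {z} 0≤i 0<n rec₁ rec₂ rb))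

module BorosMollNumbers where
  open import Data.Integer.Base as ℤ using (ℤ; +_)
  import Data.Integer.Properties as ℤ
  import Data.Integer.Tactic.RingSolver as ℤ-Solver
  open import Data.List.Base using (applyUpTo)
  open import Data.Nat.Base
  open import Data.Nat.Combinatorics
    using (_C_; nC1≡n; nCk+nC[k+1]≡[n+1]C[k+1]; k>n⇒nCk≡0; nCk≡nC[n∸k])
  open import Data.Nat.ListAction using (sum)
  open import Data.Nat.Properties
  open import Data.Nat.Tactic.RingSolver using (solve-∀)
  open import Data.Product.Base using (_,_)
  open import Relation.Binary.PropositionalEquality
  open IntegerInequalities

  -- Binomial coefficient identities.

  -- Pascal's rule splits the left side, and the induction hypothesis applies at both `k` and
  -- `suc k`.
  absorption : ∀ n k → suc k * (suc n C suc k) ≡ suc n * (n C k)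
  absorption zero    zero    = refl
  absorption zero    (suc k) =
    trans (cong (suc (suc k) *_) (k>n⇒nCk≡0 {1} {suc (suc k)} (s<s z<s))) (*-zeroʳ (suc (suc k)))
  absorption (suc n) zero    =
    trans (*-identityˡ (suc (suc n) C 1)) (trans (nC1≡n (suc (suc n))) (sym (*-identityʳ (suc (suc n)))))
  absorption (suc n) (suc k) = begin
    suc (suc k) * (suc (suc n) C suc (suc k))
      ≡⟨ cong (suc (suc k) *_) (nCk+nC[k+1]≡[n+1]C[k+1] (suc n) (suc k)) ⟨
    suc (suc k) * ((suc n C suc k) + (suc n C suc (suc k)))
      ≡⟨ *-distribˡ-+ (suc (suc k)) (suc n C suc k) (suc n C suc (suc k)) ⟩
    (suc n C suc k) + suc k * (suc n C suc k) + suc (suc k) * (suc n C suc (suc k))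
      ≡⟨ cong₂ (λ x y → (suc n C suc k) + x + y) (absorption n k) (absorption n (suc k)) ⟩
    (suc n C suc k) + suc n * (n C k) + suc n * (n C suc k)
      ≡⟨ +-assoc (suc n C suc k) _ _ ⟩
    (suc n C suc k) + (suc n * (n C k) + suc n * (n C suc k))
      ≡⟨ cong (_+_ (suc n C suc k)) (*-distribˡ-+ (suc n) (n C k) (n C suc k)) ⟨
    (suc n C suc k) + suc n * ((n C k) + (n C suc k))
      ≡⟨ cong (λ x → (suc n C suc k) + suc n * x) (nCk+nC[k+1]≡[n+1]C[k+1] n k) ⟩
    suc (suc n) * (suc n C suc k) ∎
    where open ≡-Reasoning

  -- This is (n - k) C(n,k) = (k+1) C(n,k+1) written without subtraction. Adding C(n,k) to both
  -- sides reduces it to `absorption` and Pascal's rule.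
  upper-absorption : ∀ n k → n * (n C k) ≡ suc k * (n C suc k) + k * (n C k)
  upper-absorption n k = +-cancelˡ-≡ (n C k) _ _ (begin
    suc n * (n C k)                          ≡⟨ absorption n k ⟨
    suc k * (suc n C suc k)                  ≡⟨ cong (suc k *_) (nCk+nC[k+1]≡[n+1]C[k+1] n k) ⟨
    suc k * ((n C k) + (n C suc k))          ≡⟨ rearrange k (n C k) (n C suc k) ⟩
    (n C k) + (suc k * (n C suc k) + k * (n C k)) ∎)
    where
    open ≡-Reasoning
    rearrange : ∀ k x y → (1 + k) * (x + y) ≡ x + ((1 + k) * y + k * x)
    rearrange = solve-∀

  -- The extra factor `suc p` allows `absorption` to be applied twice, with the symmetry C(2p+1,p) =
  -- C(2p+1,p+1) in between.
  central-binomial-step : ∀ p →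
    suc p * ((2 * suc p) C suc p) ≡ 2 * (2 * p + 1) * ((2 * p) C p)
  central-binomial-step p = *-cancelˡ-≡ _ _ (suc p) (begin
    suc p * (suc p * ((2 * suc p) C suc p))
      ≡⟨ cong (λ t → suc p * (suc p * (t C suc p))) (*-suc 2 p) ⟩
    suc p * (suc p * (suc (suc (2 * p)) C suc p))
      ≡⟨ cong (suc p *_) (absorption (suc (2 * p)) p) ⟩
    suc p * (suc (suc (2 * p)) * (suc (2 * p) C p))
      ≡⟨ cong (λ t → suc p * (suc (suc (2 * p)) * t)) symmetric ⟩
    suc p * (suc (suc (2 * p)) * (suc (2 * p) C suc p))
      ≡⟨ swap (suc p) (suc (suc (2 * p))) (suc (2 * p) C suc p) ⟩
    suc (suc (2 * p)) * (suc p * (suc (2 * p) C suc p))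
      ≡⟨ cong (suc (suc (2 * p)) *_) (absorption (2 * p) p) ⟩
    suc (suc (2 * p)) * (suc (2 * p) * ((2 * p) C p))
      ≡⟨ factor p ((2 * p) C p) ⟩
    suc p * (2 * (2 * p + 1) * ((2 * p) C p)) ∎)
    where
    open ≡-Reasoning
    swap : ∀ x y z → x * (y * z) ≡ y * (x * z)
    swap = solve-∀
    factor : ∀ p x → (2 + 2 * p) * ((1 + 2 * p) * x) ≡ (1 + p) * (2 * (2 * p + 1) * x)
    factor = solve-∀
    1+2p≡p+1+p : ∀ p → 1 + 2 * p ≡ p + (1 + p)
    1+2p≡p+1+p = solve-∀
    symmetric : suc (2 * p) C p ≡ suc (2 * p) C suc p
    symmetric = trans
      (nCk≡nC[n∸k] (subst (p ≤_) (sym (1+2p≡p+1+p p)) (m≤m+n p (suc p))))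
      (cong (suc (2 * p) C_) (trans (cong (_∸ p) (1+2p≡p+1+p p)) (m+n∸m≡n p (suc p))))

  nCk≢0 : ∀ {n k} → k ≤ n → NonZero (n C k)
  nCk≢0 {n}     {zero}  k≤n       = _
  nCk≢0 {suc n} {suc k} (s≤s k≤n) =
    subst NonZero (nCk+nC[k+1]≡[n+1]C[k+1] n k)
      (>-nonZero (<-≤-trans (>-nonZero⁻¹ _ {{nCk≢0 k≤n}}) (m≤m+n (n C k) (n C suc k))))

  -- The summands of the Boros-Moll numbers and the scaled numbers D_i.

  coeff : ℕ → ℕ → ℕ
  coeff m k = 2 ^ k * ((2 * m ∸ 2 * k) C (m ∸ k)) * ((m + k) C k)

  coeff-positive : ∀ {m k} → k ≤ m → 0 < coeff m k
  coeff-positive {m} {k} k≤m = >-nonZero⁻¹ (coeff m k)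
    where
    instance
      _ = m^n≢0 2 k
      _ = nCk≢0 {2 * m ∸ 2 * k} {m ∸ k}
            (subst (m ∸ k ≤_) (*-distribˡ-∸ 2 m k) (m≤n*m (m ∸ k) 2))
      _ = nCk≢0 {m + k} {k} (m≤n+m k m)
      _ = m*n≢0 (2 ^ k) ((2 * m ∸ 2 * k) C (m ∸ k))
      _ = m*n≢0 (2 ^ k * ((2 * m ∸ 2 * k) C (m ∸ k))) ((m + k) C k)

  -- The term ratio of a hypergeometric sum, with `p` = m - k - 1: the central binomial coefficient
  -- drops from `suc p` to `p`, and `absorption` handles C(m+k,k).
  coeff-step : ∀ k p → let m = suc (k + p) in
    suc k * (2 * p + 1) * coeff m (suc k) ≡ suc p * suc (m + k) * coeff m k
  coeff-step k p = begin
    suc k * (2 * p + 1) * coeff m (suc k)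
      ≡⟨ cong₂ (λ x y → suc k * (2 * p + 1) * (2 * 2 ^ k * x * y))
           (binomial (suc k) p m∸1+k≡p) (cong (_C suc k) (+-suc m k)) ⟩
    suc k * (2 * p + 1) * (2 * 2 ^ k * ((2 * p) C p) * (suc (m + k) C suc k))
      ≡⟨ rearrange₁ (suc k) (2 * p + 1) (2 ^ k) ((2 * p) C p) (suc (m + k) C suc k) ⟩
    2 ^ k * (2 * (2 * p + 1) * ((2 * p) C p)) * (suc k * (suc (m + k) C suc k))
      ≡⟨ cong₂ (λ x y → 2 ^ k * x * y) (sym (central-binomial-step p)) (absorption (m + k) k) ⟩
    2 ^ k * (suc p * ((2 * suc p) C suc p)) * (suc (m + k) * ((m + k) C k))
      ≡⟨ rearrange₂ (suc p) (suc (m + k)) (2 ^ k) ((2 * suc p) C suc p) ((m + k) C k) ⟩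
    suc p * suc (m + k) * (2 ^ k * ((2 * suc p) C suc p) * ((m + k) C k))
      ≡⟨ cong (λ x → suc p * suc (m + k) * (2 ^ k * x * ((m + k) C k))) (binomial k (suc p) m∸k≡1+p) ⟨
    suc p * suc (m + k) * coeff m k ∎
    where
    open ≡-Reasoning
    m : ℕ
    m = suc (k + p)
    m∸1+k≡p : m ∸ suc k ≡ p
    m∸1+k≡p = m+n∸m≡n k p
    m∸k≡1+p : m ∸ k ≡ suc p
    m∸k≡1+p = trans (cong (_∸ k) (sym (+-suc k p))) (m+n∸m≡n k (suc p))
    binomial : ∀ k q → m ∸ k ≡ q → (2 * m ∸ 2 * k) C (m ∸ k) ≡ (2 * q) C q
    binomial k q m∸k≡q = cong₂ _C_ (trans (sym (*-distribˡ-∸ 2 m k)) (cong (2 *_) m∸k≡q)) m∸k≡q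
    rearrange₁ : ∀ a b c x y → a * b * (2 * c * x * y) ≡ c * (2 * b * x) * (a * y)
    rearrange₁ = solve-∀
    rearrange₂ : ∀ a b c x y → c * (a * x) * (b * y) ≡ a * b * (c * x * y)
    rearrange₂ = solve-∀

  -- The integer D_j = 4^m d_j(m), shaped so that it agrees definitionally with the numerator inside
  -- `d`.
  numerator : ℕ → ℕ → ℕ
  numerator m j = ∑[ j ⋯ m ] (λ k → coeff m k * (k C j))

  sum-drop-zeros : ∀ j N (f : ℕ → ℕ) → (∀ {k} → k < j → f k ≡ 0) →
    sum (applyUpTo (λ k → f (j + k)) (N ∸ j)) ≡ sum (applyUpTo f N)
  sum-drop-zeros zero    N       f f≡0 = refl
  sum-drop-zeros (suc j) zero    f f≡0 = refl
  sum-drop-zeros (suc j) (suc N) f f≡0 =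
    trans (sum-drop-zeros j N (λ k → f (suc k)) (λ k<j → f≡0 (s<s k<j)))
      (cong (_+ sum (applyUpTo (λ k → f (suc k)) N)) (sym (f≡0 z<s)))

  -- The recurrence involves three sums with different starting points. Since C(k,j) = 0 for k < j,
  -- all of them extend to the common range from 0 to m.
  numerator-full-sum : ∀ m j →
    numerator m j ≡ sum (applyUpTo (λ k → coeff m k * (k C j)) (suc m))
  numerator-full-sum m j = sum-drop-zeros j (suc m) _ λ {k} k<j →
    trans (cong (coeff m k *_) (k>n⇒nCk≡0 k<j)) (*-zeroʳ (coeff m k))

  numerator-positive : ∀ {m j} → j ≤ m → 0 < numerator m j
  numerator-positive {m} {j} j≤m =
    subst (λ N → 0 < sum (applyUpTo (λ k → coeff m (j + k) * ((j + k) C j)) N))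
      (sym (+-∸-assoc 1 j≤m)) (<-≤-trans first (m≤m+n _ _))
    where
    j+0≤m : j + 0 ≤ m
    j+0≤m = subst (_≤ m) (sym (+-identityʳ j)) j≤m
    first : 0 < coeff m (j + 0) * ((j + 0) C j)
    first = *-mono-< (coeff-positive j+0≤m)
      (>-nonZero⁻¹ _ {{nCk≢0 (≤-reflexive (sym (+-identityʳ j)))}})

  -- The three-term recurrence by creative telescoping.

  telescope : ∀ N (a b c : ℤ) (f g h : ℕ → ℕ) (T : ℕ → ℤ) →
    (∀ {k} → k < N →
      T k ℤ.+ (a ℤ.* + f k ℤ.+ c ℤ.* + h k ℤ.- b ℤ.* + g k) ≡ T (suc k)) →
    T 0 ℤ.+ (a ℤ.* + sum (applyUpTo f N) ℤ.+ c ℤ.* + sum (applyUpTo h N)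
      ℤ.- b ℤ.* + sum (applyUpTo g N)) ≡ T N
  telescope zero a b c f g h T step = vanish a b c (T 0)
    where
    vanish : ∀ a b c t → t ℤ.+ (a ℤ.* + 0 ℤ.+ c ℤ.* + 0 ℤ.- b ℤ.* + 0) ≡ t
    vanish = ℤ-Solver.solve-∀
  telescope (suc N) a b c f g h T step = begin
    _ ≡⟨ split a b c (T 0) (+ f 0) (+ g 0) (+ h 0) _ _ _ ⟩
    T 0 ℤ.+ (a ℤ.* + f 0 ℤ.+ c ℤ.* + h 0 ℤ.- b ℤ.* + g 0) ℤ.+ _
      ≡⟨ cong (ℤ._+ _) (step z<s) ⟩
    T 1 ℤ.+ _
      ≡⟨ telescope N a b c (λ k → f (suc k)) (λ k → g (suc k)) (λ k → h (suc k))
           (λ k → T (suc k)) (λ k<N → step (s<s k<N)) ⟩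
    T (suc N) ∎
    where
    open ≡-Reasoning
    split : ∀ a b c t f₀ g₀ h₀ f g h →
      t ℤ.+ (a ℤ.* (f₀ ℤ.+ f) ℤ.+ c ℤ.* (h₀ ℤ.+ h) ℤ.- b ℤ.* (g₀ ℤ.+ g)) ≡
      t ℤ.+ (a ℤ.* f₀ ℤ.+ c ℤ.* h₀ ℤ.- b ℤ.* g₀) ℤ.+
        (a ℤ.* f ℤ.+ c ℤ.* h ℤ.- b ℤ.* g)
    split = ℤ-Solver.solve-∀

  -- The k-th term of the recurrence for the sums over k is flux (k + 1) - flux k.  The factor
  -- m - k makes the flux vanish at k = m + 1, where the closed form below would not.
  flux : ℕ → ℕ → ℕ → ℤ
  flux m j zero    = + 0
  flux m j (suc k) = (+ m ℤ.- + k) ℤ.* (+ m ℤ.+ + k ℤ.+ + 1) ℤ.* (+ (coeff m k * (k C j)))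

  -- The definition expresses the flux through the weight at k - 1; the difference needs it through
  -- the weight at k. `coeff-step` moves the coefficient and `absorption` the binomial; at k = 0
  -- both sides are 0.
  flux-closed-form : ∀ {m k} j → k ≤ m →
    flux m j k ≡
    (+ 2 ℤ.* (+ m ℤ.- + k) ℤ.+ + 1) ℤ.* (+ j ℤ.+ + 1) ℤ.* + (coeff m k * (k C suc j))
  flux-closed-form {m} {zero} j _ = sym (trans
    (cong (λ t → (+ 2 ℤ.* (+ m ℤ.- + 0) ℤ.+ + 1) ℤ.* (+ j ℤ.+ + 1) ℤ.* + t)
      (trans (cong (coeff m 0 *_) (k>n⇒nCk≡0 {0} {suc j} z<s)) (*-zeroʳ (coeff m 0))))
    (ℤ.*-zeroʳ ((+ 2 ℤ.* (+ m ℤ.- + 0) ℤ.+ + 1) ℤ.* (+ j ℤ.+ + 1))))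
  flux-closed-form {m} {suc k} j k<m with p , refl ← m≤n⇒∃[o]m+o≡n k<m = begin
    (+ m ℤ.- + k) ℤ.* (+ m ℤ.+ + k ℤ.+ + 1) ℤ.* + (coeff m k * (k C j))
      ≡⟨ left (+ k) (+ p) (+ m) (+ (coeff m k * (k C j))) ⟩
    + suc p ℤ.* + suc (m + k) ℤ.* + (coeff m k * (k C j))
      ≡⟨ cast (suc p) (suc (m + k)) (coeff m k * (k C j)) ⟨
    + (suc p * suc (m + k) * (coeff m k * (k C j)))
      ≡⟨ cong +_ step ⟩
    + ((2 * p + 1) * suc j * (coeff m (suc k) * (suc k C suc j)))
      ≡⟨ cast (2 * p + 1) (suc j) (coeff m (suc k) * (suc k C suc j)) ⟩
    + (2 * p + 1) ℤ.* + suc j ℤ.* + (coeff m (suc k) * (suc k C suc j))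
      ≡⟨ cong (λ t → (t ℤ.+ + 1) ℤ.* + suc j ℤ.* + (coeff m (suc k) * (suc k C suc j))) (ℤ.pos-* 2 p) ⟩
    (+ 2 ℤ.* + p ℤ.+ + 1) ℤ.* + suc j ℤ.* + (coeff m (suc k) * (suc k C suc j))
      ≡⟨ right (+ k) (+ p) (+ j) (+ (coeff m (suc k) * (suc k C suc j))) ⟩
    (+ 2 ℤ.* (+ m ℤ.- + suc k) ℤ.+ + 1) ℤ.* (+ j ℤ.+ + 1) ℤ.*
      + (coeff m (suc k) * (suc k C suc j)) ∎
    where
    open ≡-Reasoning
    cast : ∀ x y z → + (x * y * z) ≡ + x ℤ.* + y ℤ.* + z
    cast x y z = trans (ℤ.pos-* (x * y) z) (cong (ℤ._* + z) (ℤ.pos-* x y))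
    left : ∀ k p m x →
      (+ 1 ℤ.+ k ℤ.+ p ℤ.- k) ℤ.* (m ℤ.+ k ℤ.+ + 1) ℤ.* x ≡
      (+ 1 ℤ.+ p) ℤ.* (+ 1 ℤ.+ (m ℤ.+ k)) ℤ.* x
    left = ℤ-Solver.solve-∀
    right : ∀ k p j x →
      (+ 2 ℤ.* p ℤ.+ + 1) ℤ.* (+ 1 ℤ.+ j) ℤ.* x ≡
      (+ 2 ℤ.* (+ 1 ℤ.+ k ℤ.+ p ℤ.- (+ 1 ℤ.+ k)) ℤ.+ + 1) ℤ.* (j ℤ.+ + 1) ℤ.* x
    right = ℤ-Solver.solve-∀
    regroup : ∀ a b c x → a * b * (c * x) ≡ (a * b * c) * x
    regroup = solve-∀
    regroup′ : ∀ a b c x → a * b * c * x ≡ b * c * (a * x)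
    regroup′ = solve-∀
    regroup″ : ∀ b c a x → b * c * (a * x) ≡ b * a * (c * x)
    regroup″ = solve-∀
    step : suc p * suc (m + k) * (coeff m k * (k C j)) ≡
           (2 * p + 1) * suc j * (coeff m (suc k) * (suc k C suc j))
    step = begin
      suc p * suc (m + k) * (coeff m k * (k C j))
        ≡⟨ regroup (suc p) (suc (m + k)) (coeff m k) (k C j) ⟩
      suc p * suc (m + k) * coeff m k * (k C j)
        ≡⟨ cong (_* (k C j)) (coeff-step k p) ⟨
      suc k * (2 * p + 1) * coeff m (suc k) * (k C j)
        ≡⟨ regroup′ (suc k) (2 * p + 1) (coeff m (suc k)) (k C j) ⟩
      (2 * p + 1) * coeff m (suc k) * (suc k * (k C j))
        ≡⟨ cong ((2 * p + 1) * coeff m (suc k) *_) (absorption k j) ⟨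
      (2 * p + 1) * coeff m (suc k) * (suc j * (suc k C suc j))
        ≡⟨ regroup″ (2 * p + 1) (coeff m (suc k)) (suc j) (suc k C suc j) ⟩
      (2 * p + 1) * suc j * (coeff m (suc k) * (suc k C suc j)) ∎

  defect : ℕ → ℕ → ℕ → ℤ
  defect m j k =
    n ℤ.* (+ 2 ℤ.* i ℤ.+ n ℤ.+ + 1) ℤ.* + (coeff m k * (k C j))
    ℤ.+ (i ℤ.+ + 1) ℤ.* (i ℤ.+ + 2) ℤ.* + (coeff m k * (k C suc (suc j)))
    ℤ.- (i ℤ.+ + 1) ℤ.* (+ 2 ℤ.* i ℤ.+ + 2 ℤ.* n ℤ.+ + 1) ℤ.* + (coeff m k * (k C suc j))
    where
    i n : ℤ
    i = + j
    n = + m ℤ.- + j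

  flux-step : ∀ {m k} j → k ≤ m → flux m j k ℤ.+ defect m j k ≡ flux m j (suc k)
  flux-step {m} {k} j k≤m = trans (cong (ℤ._+ defect m j k) (flux-closed-form j k≤m))
    -- The first cofactor comes from (m-j)(m+j+1) - (m-k)(m+k+1) = (k-j)(k+j+1), the second from the
    -- coefficient (j+1)(j+2) of the weight with C(k,j+2).
    (add-multiple (+ k ℤ.+ + j ℤ.+ + 1) (weighted-absorption j)
      (add-multiple (ℤ.- (+ j ℤ.+ + 1)) (weighted-absorption (suc j))
        (identity (+ m) (+ j) (+ k) (+ (coeff m k * (k C j)))
          (+ (coeff m k * (k C suc j))) (+ (coeff m k * (k C suc (suc j)))))))
    where
    regroup : ∀ c k x → k * (c * x) ≡ c * (k * x)
    regroup = solve-∀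
    distribute : ∀ c j x y → c * ((1 + j) * y + j * x) ≡ (1 + j) * (c * y) + j * (c * x)
    distribute = solve-∀
    weighted-absorption : ∀ j → + k ℤ.* + (coeff m k * (k C j)) ≡
      (+ 1 ℤ.+ + j) ℤ.* + (coeff m k * (k C suc j)) ℤ.+ + j ℤ.* + (coeff m k * (k C j))
    weighted-absorption j = begin
      + k ℤ.* + (coeff m k * (k C j))
        ≡⟨ ℤ.pos-* k _ ⟨
      + (k * (coeff m k * (k C j)))
        ≡⟨ cong +_ (regroup (coeff m k) k (k C j)) ⟩
      + (coeff m k * (k * (k C j)))
        ≡⟨ cong (λ t → + (coeff m k * t)) (upper-absorption k j) ⟩
      + (coeff m k * (suc j * (k C suc j) + j * (k C j)))
        ≡⟨ cong +_ (distribute (coeff m k) j (k C j) (k C suc j)) ⟩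
      + (suc j * (coeff m k * (k C suc j))) ℤ.+ + (j * (coeff m k * (k C j)))
        ≡⟨ cong₂ ℤ._+_ (ℤ.pos-* (suc j) _) (ℤ.pos-* j _) ⟩
      + suc j ℤ.* + (coeff m k * (k C suc j)) ℤ.+ + j ℤ.* + (coeff m k * (k C j)) ∎
      where open ≡-Reasoning
    identity : ∀ m i k x y z →
      (+ 2 ℤ.* (m ℤ.- k) ℤ.+ + 1) ℤ.* (i ℤ.+ + 1) ℤ.* y ℤ.+
        ((m ℤ.- i) ℤ.* (+ 2 ℤ.* i ℤ.+ (m ℤ.- i) ℤ.+ + 1) ℤ.* x
         ℤ.+ (i ℤ.+ + 1) ℤ.* (i ℤ.+ + 2) ℤ.* z
         ℤ.- (i ℤ.+ + 1) ℤ.* (+ 2 ℤ.* i ℤ.+ + 2 ℤ.* (m ℤ.- i) ℤ.+ + 1) ℤ.* y) ≡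
      (m ℤ.- k) ℤ.* (m ℤ.+ k ℤ.+ + 1) ℤ.* x
        ℤ.+ (k ℤ.+ i ℤ.+ + 1) ℤ.*
          (k ℤ.* x ℤ.- ((+ 1 ℤ.+ i) ℤ.* y ℤ.+ i ℤ.* x))
        ℤ.+ (ℤ.- (i ℤ.+ + 1)) ℤ.*
          (k ℤ.* y ℤ.- ((+ 1 ℤ.+ (+ 1 ℤ.+ i)) ℤ.* z ℤ.+ (+ 1 ℤ.+ i) ℤ.* y))
    identity = ℤ-Solver.solve-∀

  numerator-recurrence : ∀ m j → Recurrence (+ j) (+ m ℤ.- + j)
    (+ numerator m j) (+ numerator m (suc j)) (+ numerator m (suc (suc j)))
  numerator-recurrence m j
    rewrite numerator-full-sum m j
          | numerator-full-sum m (suc j)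
          | numerator-full-sum m (suc (suc j)) =
    ℤ.i-j≡0⇒i≡j _ _ (begin
      -- The added zero is `flux m j 0`; the sum collapses to `flux m j (suc m)`, which has the
      -- factor m - m.
      _ ≡⟨ ℤ.+-identityˡ _ ⟨
      _ ≡⟨ telescope (suc m)
             ((+ m ℤ.- + j) ℤ.* (+ 2 ℤ.* + j ℤ.+ (+ m ℤ.- + j) ℤ.+ + 1))
             ((+ j ℤ.+ + 1) ℤ.* (+ 2 ℤ.* + j ℤ.+ + 2 ℤ.* (+ m ℤ.- + j) ℤ.+ + 1))
             ((+ j ℤ.+ + 1) ℤ.* (+ j ℤ.+ + 2))
             (weight j) (weight (suc j)) (weight (suc (suc j))) (flux m j)
             (λ k<1+m → flux-step j (s≤s⁻¹ k<1+m)) ⟩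
      (+ m ℤ.- + m) ℤ.* (+ m ℤ.+ + m ℤ.+ + 1) ℤ.* + (coeff m m * (m C j))
        ≡⟨ cong (λ t → t ℤ.* (+ m ℤ.+ + m ℤ.+ + 1) ℤ.* + (coeff m m * (m C j)))
             (ℤ.+-inverseʳ (+ m)) ⟩
      + 0 ∎)
    where
    open ≡-Reasoning
    weight : ℕ → ℕ → ℕ
    weight j k = coeff m k * (k C j)

  numerator-recurrence-+ : ∀ {m} j p → j + p ≡ m → Recurrence (+ j) (+ p)
    (+ numerator m j) (+ numerator m (suc j)) (+ numerator m (suc (suc j)))
  numerator-recurrence-+ {m} j p refl = subst
    (λ t → Recurrence (+ j) t (+ numerator m j) (+ numerator m (suc j)) (+ numerator m (suc (suc j))))
    (cancel (+ j) (+ p)) (numerator-recurrence m j)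
    where
    cancel : ∀ j p → j ℤ.+ p ℤ.- j ≡ p
    cancel = ℤ-Solver.solve-∀

  -- Induction on n = m - i, that is, downwards from i = m.
  ratioBounds : ∀ {m i} n → i + n ≡ m →
    RatioBounds (+ i) (+ n) (+ numerator m i) (+ numerator m (suc i))
  ratioBounds {m} {i} zero i+0≡m with refl ← trans (sym (+-identityʳ i)) i+0≡m
    -- `numerator i (suc i)` has `i ∸ i` terms, so it becomes the empty sum and both slacks are 0.
    rewrite n∸n≡0 i = bounds
      (ℤ.≤-reflexive (sym (lower (+ i) (+ numerator i i))))
      (ℤ.≤-reflexive (sym (upper (+ i) (+ numerator i i))))
    where
    lower : ∀ i x → (+ 2 ℤ.* i ℤ.+ + 3) ℤ.* + 0 ℤ.- + 2 ℤ.* + 0 ℤ.* x ≡ + 0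
    lower = ℤ-Solver.solve-∀
    upper : ∀ i x → + 0 ℤ.* x ℤ.- (i ℤ.+ + 1) ℤ.* + 0 ≡ + 0
    upper = ℤ-Solver.solve-∀
  ratioBounds {m} {i} (suc n) i+1+n≡m =
    ratioBounds-step {+ i} {+ n} {+ numerator m i} {+ numerator m (suc i)} {+ numerator m (suc (suc i))}
      (ℤ.+≤+ z≤n) (ℤ.+≤+ z≤n) (ℤ.+≤+ z≤n)
      (numerator-recurrence-+ i (suc n) i+1+n≡m)
      (ratioBounds n (trans (sym (+-suc i n)) i+1+n≡m))

-- Quotients of differences of fractions over a common denominator.

module RationalQuotients where
  open import Data.Integer.Base as ℤ using (ℤ; +_; +[1+_])
  import Data.Integer.Properties as ℤ
  open import Data.Integer.Tactic.RingSolver using (solve-∀)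
  open import Data.Nat.Base as ℕ using (ℕ; suc)
  import Data.Nat.Properties as ℕ
  open import Data.Product.Base using (Σ; _,_)
  open import Data.Rational.Base
  open import Data.Rational.Properties
  open import Data.Rational.Unnormalised.Base as ℚᵘ using (mkℚᵘ; *≡*; *<*) renaming (_≃_ to _≃ᵘ_)
  import Data.Rational.Unnormalised.Properties as ℚᵘ
  open import Relation.Binary.PropositionalEquality using (_≡_; refl; sym; trans; cong; subst; subst₂)

  -- Division in ℚ reduces to lowest terms. Passing to unnormalised fractions keeps numerators and
  -- denominators explicit for cross-multiplication.
  toℚᵘ-/ : ∀ p q → toℚᵘ (p / suc q) ≃ᵘ mkℚᵘ p q
  toℚᵘ-/ p q = toℚᵘ-fromℚᵘ (mkℚᵘ p q)

  cross-difference : ∀ w x y z q .{{_ : ℕ.NonZero q}} →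
    (w / q) * (x / q) - (y / q) * (z / q) ≡
    _/_ (w ℤ.* x ℤ.- y ℤ.* z) (q ℕ.* q) {{ℕ.m*n≢0 q q}}
  cross-difference w x y z (suc q) = toℚᵘ-injective (begin
    toℚᵘ (w/q * x/q - y/q * z/q)
      ≈⟨ toℚᵘ-homo-+ (w/q * x/q) (- (y/q * z/q)) ⟩
    toℚᵘ (w/q * x/q) ℚᵘ.+ toℚᵘ (- (y/q * z/q))
      ≈⟨ ℚᵘ.+-cong (product w x) (ℚᵘ.≃-trans (toℚᵘ-homo‿- (y/q * z/q)) (ℚᵘ.-‿cong (product y z))) ⟩
    mkℚᵘ w q ℚᵘ.* mkℚᵘ x q ℚᵘ.- mkℚᵘ y q ℚᵘ.* mkℚᵘ z q
      -- `mkℚᵘ` stores the denominator minus one, and `suc q * suc q` is the successor of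
      -- `q + q * suc q`.
      ≈⟨ *≡* (common-denominator (w ℤ.* x) (y ℤ.* z) (+ (suc q ℕ.* suc q))) ⟩
    mkℚᵘ (w ℤ.* x ℤ.- y ℤ.* z) (q ℕ.+ q ℕ.* suc q)
      ≈⟨ toℚᵘ-/ (w ℤ.* x ℤ.- y ℤ.* z) (q ℕ.+ q ℕ.* suc q) ⟨
    toℚᵘ ((w ℤ.* x ℤ.- y ℤ.* z) / (suc q ℕ.* suc q)) ∎)
    where
    open ℚᵘ.≃-Reasoning
    w/q x/q y/q z/q : ℚ
    w/q = w / suc q
    x/q = x / suc q
    y/q = y / suc q
    z/q = z / suc q
    product : ∀ x y → toℚᵘ ((x / suc q) * (y / suc q)) ≃ᵘ mkℚᵘ x q ℚᵘ.* mkℚᵘ y q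
    product x y = ℚᵘ.≃-trans (toℚᵘ-homo-* (x / suc q) (y / suc q))
      (ℚᵘ.*-cong (toℚᵘ-/ x q) (toℚᵘ-/ y q))
    common-denominator : ∀ x y q →
      (x ℤ.* q ℤ.+ ℤ.- y ℤ.* q) ℤ.* q ≡ (x ℤ.- y) ℤ.* (q ℤ.* q)
    common-denominator = solve-∀

  *<⇒<÷ : ∀ {x y z} .{{_ : Positive z}} → x * z < y → x < _÷_ y z {{pos⇒nonZero z}}
  *<⇒<÷ {x} {y} {z} xz<y = *-cancelʳ-<-nonNeg z {{pos⇒nonNeg z}} (subst (x * z <_) (sym y÷z*z≡y) xz<y)
    where
    instance
      _ = pos⇒nonZero z
    y÷z*z≡y : y ÷ z * z ≡ y
    y÷z*z≡y = trans (*-assoc y (1/ z) z)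
      (trans (cong (y *_) (*-inverseˡ z)) (*-identityʳ y))

  fraction-product-< : ∀ a b x y q .{{_ : ℕ.NonZero b}} .{{_ : ℕ.NonZero q}} →
    a ℤ.* y ℤ.< + b ℤ.* x → (a / b) * (y / q) < x / q
  fraction-product-< a (suc b) x y (suc q) ay<bx = toℚᵘ-cancel-<
    (ℚᵘ.<-respˡ-≃
      (ℚᵘ.≃-sym (ℚᵘ.≃-trans (toℚᵘ-homo-* (a / suc b) (y / suc q))
        (ℚᵘ.*-cong (toℚᵘ-/ a b) (toℚᵘ-/ y q))))
      (ℚᵘ.<-respʳ-≃ (ℚᵘ.≃-sym (toℚᵘ-/ x q))
        (*<* (subst (a ℤ.* y ℤ.* + suc q ℤ.<_) (rearrange (+ suc b) x (+ suc q))
          (ℤ.*-monoʳ-<-pos (+ suc q) ay<bx)))))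
    where
    rearrange : ∀ b x q → b ℤ.* x ℤ.* q ≡ x ℤ.* (b ℤ.* q)
    rearrange = solve-∀

  fraction-<-quotient : ∀ a b x y q .{{_ : ℕ.NonZero b}} .{{_ : ℕ.NonZero q}} →
    + 0 ℤ.< y → a ℤ.* y ℤ.< + b ℤ.* x →
    Σ (NonZero (y / q)) λ y/q≢0 → a / b < _÷_ (x / q) (y / q) {{y/q≢0}}
  fraction-<-quotient a b x (+ 0) q (ℤ.+<+ ()) _
  fraction-<-quotient a b x y@(+[1+ n ]) q _ ay<bx =
    pos⇒nonZero (y / q) , *<⇒<÷ (fraction-product-< a b x y q ay<bx)
    where
    instance
      _ = normalize-pos (suc n) q

  -- The common factor q² cancels in the quotient. The entries are given by propositional equations
  -- because `i + 1` and `i + 2` do not reduce to successors.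
  determinant-quotient-bound : ∀ {p₀ p₁ p₂ p₃} w x y z q a b
    .{{_ : ℕ.NonZero q}} .{{_ : ℕ.NonZero b}} →
    p₀ ≡ w / q → p₁ ≡ x / q → p₂ ≡ y / q → p₃ ≡ z / q →
    + 0 ℤ.< y ℤ.* y ℤ.- x ℤ.* z →
    a ℤ.* (y ℤ.* y ℤ.- x ℤ.* z) ℤ.< + b ℤ.* (x ℤ.* x ℤ.- w ℤ.* y) →
    Σ (NonZero (p₂ ² - p₁ * p₃)) λ denom≢0 →
      a / b < _÷_ (p₁ ² - p₀ * p₂) (p₂ ² - p₁ * p₃) {{denom≢0}}
  determinant-quotient-bound w x y z q a b refl refl refl refl 0<gap bound =
    subst₂ (λ s t → Σ (NonZero t) λ t≢0 → a / b < _÷_ s t {{t≢0}})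
      (sym (cross-difference x x w y q)) (sym (cross-difference y y x z q))
      (fraction-<-quotient a b _ _ (q ℕ.* q) 0<gap bound)
    where
    instance
      _ = ℕ.m*n≢0 q q

open import Data.Integer.Base as ℤ using (+_)
import Data.Integer.Properties as ℤ
open import Data.Nat.Base using (ℕ; suc; _+_; _*_; _∸_; _^_; _≤_; _<_; z≤n; z<s)
open import Data.Nat.Properties
open import Data.Product.Base using (Σ; _,_)
open import Data.Rational.Base as ℚ using (ℚ)
open import Relation.Binary.PropositionalEquality using (_≡_; refl; sym; trans; cong; cong₂; subst₂)
open IntegerInequalities
open BorosMollNumbers
open RationalQuotients

-- Transfer of the integer bounds to the Boros-Moll numbers.

cast-turán-ratio-bound : ∀ {m} i n {p q} → i + n ≡ m →
  (+ i ℤ.+ + 1) ℤ.* (+ i ℤ.+ + 2) ℤ.*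
    ((+ i ℤ.+ + n ℤ.+ + i ℤ.+ + 3) ℤ.* (+ i ℤ.+ + n ℤ.+ + i ℤ.+ + 3)) ℤ.* q ℤ.<
  (+ n ℤ.+ + 1) ℤ.* (+ n ℤ.+ + 2) ℤ.*
    ((+ i ℤ.+ + n ℤ.+ + i ℤ.+ + 2) ℤ.* (+ i ℤ.+ + n ℤ.+ + i ℤ.+ + 2)) ℤ.* p →
  + ((i + 1) * (i + 2) * (m + i + 3) ^ 2) ℤ.* q ℤ.<
  + ((m + 1 ∸ i) * (m + 2 ∸ i) * (m + i + 2) ^ 2) ℤ.* p
cast-turán-ratio-bound i n {p} {q} refl = subst₂ (λ b a → b ℤ.* q ℤ.< a ℤ.* p)
  (sym (cast (i + 1) (i + 2) (i + n + i + 3)))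
  (sym (trans (cong₂ (λ x y → + (x * y * (i + n + i + 2) ^ 2)) (shift 1) (shift 2))
    (cast (n + 1) (n + 2) (i + n + i + 2))))
  where
  cast : ∀ x y z → + (x * y * z ^ 2) ≡ + x ℤ.* + y ℤ.* (+ z ℤ.* + z)
  cast x y z = trans (ℤ.pos-* (x * y) (z ^ 2)) (cong₂ ℤ._*_ (ℤ.pos-* x y)
    (trans (cong (λ t → + (z * t)) (*-identityʳ z)) (ℤ.pos-* z z)))
  shift : ∀ k → i + n + k ∸ i ≡ n + k
  shift k = trans (cong (_∸ i) (+-assoc i n k)) (m+n∸m≡n i (n + k))

numerator-log-concave : ∀ {m i} → i < m →
  + 0 ℤ.< + numerator m (suc i) ℤ.* + numerator m (suc i)
            ℤ.- + numerator m i ℤ.* + numerator m (suc (suc i))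
-- Here `l` = m - i - 1, so the offset m - i is `suc l` at i and `l` at i + 1.
numerator-log-concave {m} {i} i<m = let l , 1+i+l≡m = m≤n⇒∃[o]m+o≡n i<m in
  log-concave {+ i} {+ l} {+ numerator m i} {+ numerator m (suc i)} {+ numerator m (suc (suc i))}
    (ℤ.+≤+ z≤n) (ℤ.+≤+ z≤n) (ℤ.+≤+ z≤n) (ℤ.+<+ (numerator-positive i<m))
    (ratioBounds (suc l) (trans (+-suc i l) 1+i+l≡m))
    (ratioBounds l 1+i+l≡m)

numerator-ratio-bound : ∀ {m i} → 1 ≤ i → i < m →
  + ((i + 1) * (i + 2) * (m + i + 3) ^ 2) ℤ.*
    (+ numerator m (suc i) ℤ.* + numerator m (suc i)
      ℤ.- + numerator m i ℤ.* + numerator m (suc (suc i))) ℤ.<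
  + ((m + 1 ∸ i) * (m + 2 ∸ i) * (m + i + 2) ^ 2) ℤ.*
    (+ numerator m i ℤ.* + numerator m i ℤ.- + numerator m (i ∸ 1) ℤ.* + numerator m (suc i))
numerator-ratio-bound {m} {i@(suc j)} _ i<m = let l , 1+i+l≡m = m≤n⇒∃[o]m+o≡n i<m in
  cast-turán-ratio-bound i (suc l) (trans (+-suc i l) 1+i+l≡m)
    (turán-ratio-bound {+ i} {+ suc l} {+ numerator m j} {+ numerator m i}
      {+ numerator m (suc i)} {+ numerator m (suc (suc i))}
      (ℤ.+≤+ z≤n) (ℤ.+<+ z<s)
      -- The recurrence at j = i - 1 has offset m - j = l + 2, and `+ suc j - + 1` computes to
      -- `+ j`.
      (numerator-recurrence-+ j (suc (suc l))
        (trans (+-suc j (suc l)) (trans (+-suc i l) 1+i+l≡m)))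
      (numerator-recurrence-+ i (suc l) (trans (+-suc i l) 1+i+l≡m))
      (ratioBounds (suc l) (trans (+-suc i l) 1+i+l≡m))
      (numerator-log-concave i<m))

theorem1p5 : ∀ (m i : ℕ) → 1 ≤ i → (i<m : i < m) →
    let numer = d m i ² ℚ.- d m (i ∸ 1) ℚ.* d m (i + 1)
        denom = d m (i + 1) ² ℚ.- d m i ℚ.* d m (i + 2)
    in Σ (ℚ.NonZero denom) λ denom≢0 →
         ℚ._/_ (+ ((i + 1) * (i + 2) * (m + i + 3) ^ 2))
               ((m + 1 ∸ i) * (m + 2 ∸ i) * (m + i + 2) ^ 2)
               {{bound-denominator≢0 i<m}}
         ℚ.< ℚ._÷_ numer denom {{denom≢0}}
theorem1p5 m i 1≤i i<m = determinant-quotient-bound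
  (+ numerator m (i ∸ 1)) (+ numerator m i) (+ numerator m (suc i)) (+ numerator m (suc (suc i)))
  (2 ^ (2 * m)) (+ ((i + 1) * (i + 2) * (m + i + 3) ^ 2))
  ((m + 1 ∸ i) * (m + 2 ∸ i) * (m + i + 2) ^ 2)
  {{m^n≢0 2 (2 * m)}} {{bound-denominator≢0 i<m}}
  -- Each `d m k` unfolds to `+ numerator m k` over `2 ^ (2 * m)`, so only `i + 1` and `i + 2` need
  -- rewriting.
  refl refl (cong (d m) (+-comm i 1)) (cong (d m) (+-comm i 2))
  (numerator-log-concave i<m) (numerator-ratio-bound 1≤i i<m)
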